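{- The bounded adaptation problem and the eventual adaptation problem are both undecidable in $\mathcal{E}_s^1$.
   Context: Fix a countably infinite set $\mathcal N$ of names $a,b,\dots$. Syntax. Prefixes are $\pi ::= a \mid \overline{a} \mid \widetilde{a}\{U\}$ (input, output, update prefix), where $U$ is an update pattern. Processes: $P ::= a[P] \mid P\parallel P \mid \sum_{i\in I}\pi_i.P_i \mid\ !\pi.P$ with $I$ finite ($\mathbf 0$ is the empty sum; $a[P]$ is the adaptable process $P$ located at $a$). Update patterns are terms of the same grammar extended with a hole $\bullet$: $U ::= \bullet \mid a[U]\mid U\parallel U\mid \sum_{i\in I}\pi_i.U_i\mid\ !\pi.U$. For a pattern $U$ and a process $Q$, $U\{Q\}$ is given by $\bullet\{Q\}=Q$, $a[U]\{Q\}=a[U\{Q\}]$, $(U_1\parallel U_2)\{Q\}=U_1\{Q\}\parallel U_2\{Q\}$, $(\sum_i\pi_i.U_i)\{Q\}=\sum_i\pi_i.(U_i\{Q\})$, $(!\pi.U)\{Q\}=!\pi.(U\{Q\})$ (holes inside update prefixes are not filled). $\prod^k P$ denotes $k$ parallel copies of $P$. Static processes $\mathcal E_s$: generated by $P::=a[P]\mid P\parallel P\mid A$, $A ::= A\parallel A\mid\ !\pi.A\mid \sum_{i\in I}\pi_i.A_i$, $\pi::= a\mid\overline a\mid \widetilde a\{a[U]\parallel A\}$, where $U$ ranges over patterns generated by this grammar with $\bullet$ added to both categories $P$ and $A$. Family restriction 1: none; so $\mathcal E_s^1=\mathcal E_s$. Auxiliary functions on patterns: $\mathrm{numap}(\bullet)=0$,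 $\mathrm{numap}(a[U])=1+\mathrm{numap}(U)$, $\mathrm{numap}(U_1\parallel U_2)=\mathrm{numap}(U_1)+\mathrm{numap}(U_2)$, $\mathrm{numap}(\sum_i\pi_i.U_i)=\mathrm{numap}(!\pi.U)=0$. $\mathrm{numholes}(\bullet)=1$, $\mathrm{numholes}(a[U])=\mathrm{numholes}(U)$, additive on $\parallel$, $\mathrm{numholes}(\sum_i\pi_i.U_i)=\sum_i\mathrm{numholes}(U_i)$, $\mathrm{numholes}(!\pi.U)=\mathrm{numholes}(U)$. $\mathrm{numph}(\bullet)=0$, $\mathrm{numph}(a[U])=\mathrm{numph}(U)$, additive on $\parallel$, $\mathrm{numph}(\sum_i\pi_i.U_i)=\sum_i\mathrm{numholes}(U_i)$, $\mathrm{numph}(!\pi.U)=\mathrm{numholes}(U)$. Every process is, up to commutativity/associativity of $\parallel$, of the form $\prod_{i=1}^m P_i\parallel\prod_{j=1}^n a_j[P'_j]$ with each $P_i$ neither a parallel composition nor located and each $P'_j$ of this form; its containment structure $\mathrm{CStr}$ is the unordered rooted tree with root labelled $\epsilon$ whose children are the roots of $\mathrm{CStr}(P'_1),\dots,\mathrm{CStr}(P'_n)$ relabelled $a_1,\dots,a_n$. Semantics. Labels $\alpha::= a\mid\overline a\mid a[P]\mid\widetilde a\{U\}\mid\tau$; $\star$ is a fresh placeholder. Rules: $a[P]\xrightarrow{a[P]}\star$; $\sum_{i\in I}\pi_i.P_i\xrightarrow{\pi_j}P_j$ ($j\in I$); $!\pi.P\xrightarrow{\pi}P\parallel!\pi.P$;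 if $P\xrightarrow\alpha P'$ then $a[P]\xrightarrow\alpha a[P']$; if $P_1\xrightarrow\alpha P_1'$ then $P_1\parallel P_2\xrightarrow\alpha P_1'\parallel P_2$ and $P_2\parallel P_1\xrightarrow\alpha P_2\parallel P_1'$; if $P_1\xrightarrow{a} P_1'$ and $P_2\xrightarrow{\overline a}P_2'$ then $P_1\parallel P_2\xrightarrow\tau P_1'\parallel P_2'$ and $P_2\parallel P_1\xrightarrow\tau P_2'\parallel P_1'$; if $P_1\xrightarrow{a[Q]}P_1'$, $P_2\xrightarrow{\widetilde a\{U\}}P_2'$ and $\mathsf{cond}(U,Q)$ then $P_1\parallel P_2\xrightarrow\tau P_1'[U\{Q\}/\star]\parallel P_2'$ and $P_2\parallel P_1\xrightarrow\tau P_2'\parallel P_1'[U\{Q\}/\star]$. For the static LTS $\to_s$, $\mathsf{cond}(U,Q)$ holds iff $U=a[U']\parallel A$ with $\mathrm{CStr}(a[Q])=\mathrm{CStr}(a[U'\{Q\}]\parallel A)$ and ($\mathrm{numph}(U)>0\Rightarrow\mathrm{numap}(Q)=0$). A reduction $P\to P'$ is $P\xrightarrow\tau P'$; $\to^*$ is its reflexive–transitive closure. Barbs and problems. For $\alpha\in\{a,\overline a\}$, $P\downarrow_\alpha$ iff $P\xrightarrow\alpha P'$ for some $P'$. For $k\ge1$, $P\Downarrow^k_\alpha$ iff there exist $Q_1,\dots,Q_k$ with $P\to^*Q_1\to Q_2\to\cdots\to Q_k$ and $Q_i\downarrow_\alpha$ for all $i$; $P\Downarrow^\omega_\alpha$ iff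 there is an infinite computation $P\to^*Q_1\to Q_2\to\cdots$ with $Q_i\downarrow_\alpha$ for all $i\ge1$. For a process $P$ and finite set $M=\{P_1,\dots,P_n\}$, $\mathcal{BC}^M_P=\{P\parallel\prod^{m_1}P_1\parallel\cdots\parallel\prod^{m_n}P_n\mid m_1,\dots,m_n\in\mathbb N\}$. Bounded adaptation: given $P$, finite $M$, a barb $e$ and $k\ge1$, decide whether no $R\in\mathcal{BC}^M_P$ satisfies $R\Downarrow^k_e$. Eventual adaptation: given $P$, $M$, $e$, decide whether no $R\in\mathcal{BC}^M_P$ satisfies $R\Downarrow^\omega_e$. Decidability "in a class" means $P$ and $M$ range over processes of that class, with that class's transition relation. -}

module Defs where

open import Data.Nat using (ℕ; zero; suc; _+_; _*_; _^_; _<_; _≤_; pred; _≡ᵇ_)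
open import Data.Bool using (Bool; true; false; if_then_else_)
open import Data.List using (List; []; _∷_; _++_; length)
open import Data.Vec using (Vec; []; _∷_)
open import Data.Maybe using (Maybe; just; nothing)
open import Data.Product using (Σ; Σ-syntax; ∃; _×_; _,_)
open import Data.Sum using (_⊎_)
open import Relation.Nullary using (¬_)
open import Relation.Binary.PropositionalEquality using (_≡_)
open import Relation.Binary.Construct.Closure.ReflexiveTransitive using (Star)

-- Syntax.  Names are natural numbers.  A single syntactic category of
-- terms covers processes, update patterns (containing the hole •) and
-- intermediate terms of the LTS (containing the placeholder ⋆).

Name : Set
Name = ℕ

mutual
  data Prefix : Set where
    inp : Name → Prefix
    out : Name → Prefix
    upd : Name → Term → Prefix

  data Term : Set where
    hole : Term                      -- •  (only in patterns)
    star : Term                      -- ⋆  (placeholder of the LTS)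
    loc  : Name → Term → Term
    par  : Term → Term → Term
    sum  : Branches → Term
    bang : Prefix → Term → Term

  data Branches : Set where
    nil  : Branches
    cons : Prefix → Term → Branches → Branches

𝟘 : Term
𝟘 = sum nil

-- Static processes E_s (= E_s^1).
-- P ::= a[P] | P ∥ P | A ;  A ::= A ∥ A | !π.A | Σ π_i.A_i ;
-- π ::= a | ā | ã{a[U] ∥ A}, U a pattern of the same grammar with •
-- added to both categories P and A.

mutual
  data StPre : Prefix → Set where
    s-inp : ∀ {a} → StPre (inp a)
    s-out : ∀ {a} → StPre (out a)
    s-upd : ∀ {a U A} → StUP U → StA A → StPre (upd a (par (loc a U) A))

  data StP : Term → Set where
    sp-loc : ∀ {a P} → StP P → StP (loc a P)
    sp-par : ∀ {P Q} → StP P → StP Q → StP (par P Q)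
    sp-A   : ∀ {A} → StA A → StP A

  data StA : Term → Set where
    sa-par  : ∀ {A B} → StA A → StA B → StA (par A B)
    sa-bang : ∀ {π A} → StPre π → StA A → StA (bang π A)
    sa-sum  : ∀ {bs} → StAs bs → StA (sum bs)

  data StAs : Branches → Set where
    sas-nil  : StAs nil
    sas-cons : ∀ {π A bs} → StPre π → StA A → StAs bs → StAs (cons π A bs)

  data StUP : Term → Set where
    sup-hole : StUP hole
    sup-loc  : ∀ {a U} → StUP U → StUP (loc a U)
    sup-par  : ∀ {U V} → StUP U → StUP V → StUP (par U V)
    sup-A    : ∀ {U} → StUA U → StUP U

  data StUA : Term → Set where
    sua-hole : StUA hole
    sua-par  : ∀ {U V} → StUA U → StUA V → StUA (par U V)
    sua-bang : ∀ {π U} → StPre π → StUA U → StUA (bang π U)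
    sua-sum  : ∀ {bs} → StUAs bs → StUA (sum bs)

  data StUAs : Branches → Set where
    suas-nil  : StUAs nil
    suas-cons : ∀ {π U bs} → StPre π → StUA U → StUAs bs → StUAs (cons π U bs)

Static : Term → Set
Static = StP

-- Pattern filling U{Q} (holes inside update prefixes are not filled)

mutual
  fill : Term → Term → Term
  fill hole       Q = Q
  fill star       Q = star
  fill (loc a U)  Q = loc a (fill U Q)
  fill (par U V)  Q = par (fill U Q) (fill V Q)
  fill (sum bs)   Q = sum (fillBs bs Q)
  fill (bang π U) Q = bang π (fill U Q)

  fillBs : Branches → Term → Branches
  fillBs nil            Q = nil
  fillBs (cons π U bs)  Q = cons π (fill U Q) (fillBs bs Q)

mutual
  substStar : Term → Term → Term
  substStar hole       X = hole
  substStar star       X = X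
  substStar (loc a P)  X = loc a (substStar P X)
  substStar (par P Q)  X = par (substStar P X) (substStar Q X)
  substStar (sum bs)   X = sum (substStarBs bs X)
  substStar (bang π P) X = bang π (substStar P X)

  substStarBs : Branches → Term → Branches
  substStarBs nil           X = nil
  substStarBs (cons π P bs) X = cons π (substStar P X) (substStarBs bs X)

numap : Term → ℕ
numap (loc a U) = suc (numap U)
numap (par U V) = numap U + numap V
numap _         = 0

mutual
  numholes : Term → ℕ
  numholes hole       = 1
  numholes star       = 0
  numholes (loc a U)  = numholes U
  numholes (par U V)  = numholes U + numholes V
  numholes (sum bs)   = numholesBs bs
  numholes (bang π U) = numholes U

  numholesBs : Branches → ℕ
  numholesBs nil           = 0
  numholesBs (cons π U bs) = numholes U + numholesBs bs

numph : Term → ℕ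
numph hole       = 0
numph star       = 0
numph (loc a U)  = numph U
numph (par U V)  = numph U + numph V
numph (sum bs)   = numholesBs bs
numph (bang π U) = numholes U

-- Containment structure: unordered rooted trees; label nothing = ε

data Tree : Set where
  node : Maybe Name → List Tree → Tree

cstrChildren : Term → List Tree
cstrChildren (loc a P) = node (just a) (cstrChildren P) ∷ []
cstrChildren (par P Q) = cstrChildren P ++ cstrChildren Q
cstrChildren _         = []

CStr : Term → Tree
CStr P = node nothing (cstrChildren P)

mutual
  data _≅_ : Tree → Tree → Set where
    node≅ : ∀ {l ts us} → ts ≅F us → node l ts ≅ node l us

  data _≅F_ : List Tree → List Tree → Set where
    []≅ : [] ≅F []
    ∷≅  : ∀ {t ts u xs ys} → t ≅ u → ts ≅F (xs ++ ys) →
          (t ∷ ts) ≅F (xs ++ (u ∷ ys))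

infix 4 _≅_ _≅F_

data Label : Set where
  lin  : Name → Label
  lout : Name → Label
  lloc : Name → Term → Label
  lupd : Name → Term → Label
  τ    : Label

prefixLabel : Prefix → Label
prefixLabel (inp a)   = lin a
prefixLabel (out a)   = lout a
prefixLabel (upd a U) = lupd a U

data _∈Br_ : Prefix × Term → Branches → Set where
  here  : ∀ {π P bs} → (π , P) ∈Br cons π P bs
  there : ∀ {π P ρ Q bs} → (π , P) ∈Br bs → (π , P) ∈Br cons ρ Q bs

condS : Name → Term → Term → Set
condS a U Q =
  Σ[ U' ∈ Term ] Σ[ A ∈ Term ]
    (U ≡ par (loc a U') A) ×
    (CStr (loc a Q) ≅ CStr (par (loc a (fill U' Q)) A)) ×
    (0 < numph U → numap Q ≡ 0)

data _—[_]→_ : Term → Label → Term → Set where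
  t-loc   : ∀ {a P} → loc a P —[ lloc a P ]→ star
  t-sum   : ∀ {π P bs} → (π , P) ∈Br bs → sum bs —[ prefixLabel π ]→ P
  t-bang  : ∀ {π P} → bang π P —[ prefixLabel π ]→ par P (bang π P)
  t-inloc : ∀ {a P P' α} → P —[ α ]→ P' → loc a P —[ α ]→ loc a P'
  t-parl  : ∀ {P₁ P₁' P₂ α} → P₁ —[ α ]→ P₁' → par P₁ P₂ —[ α ]→ par P₁' P₂
  t-parr  : ∀ {P₁ P₁' P₂ α} → P₁ —[ α ]→ P₁' → par P₂ P₁ —[ α ]→ par P₂ P₁'
  t-coml  : ∀ {a P₁ P₁' P₂ P₂'} → P₁ —[ lin a ]→ P₁' → P₂ —[ lout a ]→ P₂' →
            par P₁ P₂ —[ τ ]→ par P₁' P₂'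
  t-comr  : ∀ {a P₁ P₁' P₂ P₂'} → P₁ —[ lin a ]→ P₁' → P₂ —[ lout a ]→ P₂' →
            par P₂ P₁ —[ τ ]→ par P₂' P₁'
  t-updl  : ∀ {a Q U P₁ P₁' P₂ P₂'} → P₁ —[ lloc a Q ]→ P₁' →
            P₂ —[ lupd a U ]→ P₂' → condS a U Q →
            par P₁ P₂ —[ τ ]→ par (substStar P₁' (fill U Q)) P₂'
  t-updr  : ∀ {a Q U P₁ P₁' P₂ P₂'} → P₁ —[ lloc a Q ]→ P₁' →
            P₂ —[ lupd a U ]→ P₂' → condS a U Q →
            par P₂ P₁ —[ τ ]→ par P₂' (substStar P₁' (fill U Q))

_⟶_ : Term → Term → Set
P ⟶ P' = P —[ τ ]→ P'

_⟶*_ : Term → Term → Set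
_⟶*_ = Star _⟶_

data Barb : Set where
  bin  : Name → Barb
  bout : Name → Barb

barbLabel : Barb → Label
barbLabel (bin a)  = lin a
barbLabel (bout a) = lout a

_↓_ : Term → Barb → Set
P ↓ e = Σ[ P' ∈ Term ] (P —[ barbLabel e ]→ P')

-- Chain n e Q: Q = Q₁ → Q₂ → ⋯ → Q_{n+1}, each exhibiting e
Chain : ℕ → Barb → Term → Set
Chain zero    e Q = Q ↓ e
Chain (suc n) e Q = (Q ↓ e) × (Σ[ Q' ∈ Term ] (Q ⟶ Q') × Chain n e Q')

-- P ⇓^k_e   (meaningful for k ≥ 1)
Barbk : ℕ → Term → Barb → Set
Barbk k P e = Σ[ Q₁ ∈ Term ] (P ⟶* Q₁) × Chain (pred k) e Q₁

Barbω : Term → Barb → Set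
Barbω P e = Σ[ Q ∈ (ℕ → Term) ]
  (P ⟶* Q 0) × (∀ i → Q i ⟶ Q (suc i)) × (∀ i → Q i ↓ e)

copies : ℕ → Term → Term
copies zero    P = 𝟘
copies (suc m) P = par P (copies m P)

prodMult : (M : List Term) → Vec ℕ (length M) → Term
prodMult []      []       = 𝟘
prodMult (P ∷ M) (m ∷ ms) = par (copies m P) (prodMult M ms)

InBC : List Term → Term → Term → Set
InBC M P R = Σ[ ms ∈ Vec ℕ (length M) ] (R ≡ par P (prodMult M ms))

BInst : Set
BInst = Term × List Term × Barb × ℕ

BoundedAdaptation : BInst → Set
BoundedAdaptation (P , M , e , k) =
  ¬ (Σ[ R ∈ Term ] InBC M P R × Barbk k R e)

EInst : Set
EInst = Term × List Term × Barb

EventualAdaptation : EInst → Set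
EventualAdaptation (P , M , e) =
  ¬ (Σ[ R ∈ Term ] InBC M P R × Barbω R e)

data AllStatic : List Term → Set where
  [] : AllStatic []
  _∷_ : ∀ {P M} → Static P → AllStatic M → AllStatic (P ∷ M)

BDom : BInst → Set
BDom (P , M , e , k) = Static P × AllStatic M × (1 ≤ k)

EDom : EInst → Set
EDom (P , M , e) = Static P × AllStatic M

-- Computability: Minsky (counter) machines with unboundedly many
-- registers; input in register 0, output in register 0.

data Instr : Set where
  inc   : ℕ → ℕ → Instr          -- inc r; goto j
  jzdec : ℕ → ℕ → ℕ → Instr      -- if r = 0 goto j else (dec r; goto k)

Program : Set
Program = List Instr

nth : List Instr → ℕ → Maybe Instr
nth []       _       = nothing
nth (i ∷ is) zero    = just i
nth (i ∷ is) (suc n) = nth is n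

Regs : Set
Regs = ℕ → ℕ

setReg : ℕ → ℕ → Regs → Regs
setReg r v ρ i = if i ≡ᵇ r then v else ρ i

Config : Set
Config = ℕ × Regs

-- one step; nothing = halted (pc outside the program)
step : Program → Config → Maybe Config
step p (pc , ρ) with nth p pc
... | nothing            = nothing
... | just (inc r j)     = just (j , setReg r (suc (ρ r)) ρ)
... | just (jzdec r j k) with ρ r
...   | zero  = just (j , ρ)
...   | suc v = just (k , setReg r v ρ)

run : Program → ℕ → Config → Maybe ℕ
run p zero    c       = nothing
run p (suc f) (pc , ρ) with step p (pc , ρ)
... | nothing = just (ρ 0)
... | just c' = run p f c'

initConfig : ℕ → Config
initConfig n = 0 , (λ i → if i ≡ᵇ 0 then n else 0)

Halts : Program → ℕ → ℕ → Set
Halts p n o = Σ[ f ∈ ℕ ] run p f (initConfig n) ≡ just o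

-- Gödel numbering of instances (injective)

pair : ℕ → ℕ → ℕ
pair m n = 2 ^ m * suc (2 * n)

mutual
  codeT : Term → ℕ
  codeT hole       = pair 0 0
  codeT star       = pair 1 0
  codeT (loc a P)  = pair 2 (pair a (codeT P))
  codeT (par P Q)  = pair 3 (pair (codeT P) (codeT Q))
  codeT (sum bs)   = pair 4 (codeBs bs)
  codeT (bang π P) = pair 5 (pair (codePre π) (codeT P))

  codePre : Prefix → ℕ
  codePre (inp a)   = pair 0 a
  codePre (out a)   = pair 1 a
  codePre (upd a U) = pair 2 (pair a (codeT U))

  codeBs : Branches → ℕ
  codeBs nil           = 0
  codeBs (cons π P bs) = suc (pair (codePre π) (pair (codeT P) (codeBs bs)))

codeList : List Term → ℕ
codeList []      = 0
codeList (P ∷ M) = suc (pair (codeT P) (codeList M))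

codeBarb : Barb → ℕ
codeBarb (bin a)  = pair 0 a
codeBarb (bout a) = pair 1 a

codeB : BInst → ℕ
codeB (P , M , e , k) = pair (codeT P) (pair (codeList M) (pair (codeBarb e) k))

codeE : EInst → ℕ
codeE (P , M , e) = pair (codeT P) (pair (codeList M) (codeBarb e))

Decides : {X : Set} → (X → ℕ) → (X → Set) → (X → Set) → Program → Set
Decides code D S p =
  ∀ x → D x → Σ[ o ∈ ℕ ] Halts p (code x) o ×
                ((o ≡ 1 × S x) ⊎ (o ≡ 0 × ¬ S x))

Undecidable : {X : Set} → (X → ℕ) → (X → Set) → (X → Set) → Set
Undecidable code D S = ¬ (Σ[ p ∈ Program ] Decides code D S p)

{-# OPTIONS --safe #-}
module Submission where

-- A decider p is refuted by diagonalisation.  A register machine d and an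
-- input c are encoded as the process T ∥ r₀[c], where T (control and the
-- remaining registers) depends on d only; a fixed barb is observable
-- in some reachable state iff d halts on c, and then it persists along an infinite
-- run, so the two problems need only one encoding (with M = ∅ and k = 1).
-- Take d to be: from c compute the code of the instance whose skeleton T has
-- code c, run p on it, and halt iff p answers 1.  Running d on the code of its
-- own skeleton makes p wrong; no Gödel numbering of machines is needed.

open import Defs
open import Data.Nat using (ℕ; zero; suc; _+_; _*_; _^_; _≤_; _<_; _⊔_; _⊓_; _≡ᵇ_; z≤n; s≤s)
open import Data.Nat.Properties
open import Data.Bool using (true; false)
open import Data.Empty using (⊥-elim)
open import Data.Fin using (Fin; zero; suc; toℕ)
open import Data.List using (List; []; _∷_; _++_; length; map)
open import Data.List.Properties using (length-++; length-map)
open import Data.Maybe using (just; nothing)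
open import Data.Maybe.Properties using (just-injective)
open import Data.Product using (Σ-syntax; ∃-syntax; _×_; _,_; proj₁; proj₂)
open import Data.Sum using (_⊎_; inj₁; inj₂)
open import Data.Vec using (Vec; []; _∷_; lookup; _[_]≔_)
open import Relation.Nullary using (¬_)
open import Relation.Binary.PropositionalEquality
open import Relation.Binary.Construct.Closure.ReflexiveTransitive using (Star; ε; _◅_; _◅◅_)

-- Counter machines

-- Two demands shape the construction. The machine must assemble the code of its own instance from
-- the code c of T alone. Register 0 is therefore kept out of T and put beside it as the outermost
-- component: T occurs literally as a subterm, and the code wanted is a few applications of `pair`
-- to c and to the code of r₀[c], which a loop over c builds. Second, zero tests must be faithful: a
-- process that may guess wrongly could show the barb although d does not halt. Here the contents of
-- a register decide which test succeeds; nested prefixes make this possible, and the update needed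
-- for an increment keeps the containment structure.
--
-- Transitions are not taken modulo structural congruence, so inert residues pile up. The states are
-- therefore described by inductive predicates that tolerate such debris, and every transition is
-- classified by inversion.

setReg-same : ∀ r v ρ → setReg r v ρ r ≡ v
setReg-same zero    v ρ = refl
setReg-same (suc r) v ρ = setReg-same r v (λ q → ρ (suc q))

setReg-other : ∀ r v ρ q → q ≢ r → setReg r v ρ q ≡ ρ q
setReg-other zero    v ρ zero    q≢r = ⊥-elim (q≢r refl)
setReg-other zero    v ρ (suc q) q≢r = refl
setReg-other (suc r) v ρ zero    q≢r = refl
setReg-other (suc r) v ρ (suc q) q≢r =
  setReg-other r v (λ i → ρ (suc i)) q (λ eq → q≢r (cong suc eq))

setReg-cong : ∀ r {v w ρ σ} → v ≡ w → ρ ≗ σ → setReg r v ρ ≗ setReg r w σ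
setReg-cong r refl ρ≗σ q with q ≡ᵇ r
... | true  = refl
... | false = ρ≗σ q

-- Program counter 0 is the halting address; address suc i holds entry i.
data Step (d : Program) : Config → Config → Set where
  s-inc  : ∀ {i r j ρ} → nth d i ≡ just (inc r j) →
           Step d (suc i , ρ) (j , setReg r (suc (ρ r)) ρ)
  s-zero : ∀ {i r j k ρ} → nth d i ≡ just (jzdec r j k) → ρ r ≡ 0 →
           Step d (suc i , ρ) (j , ρ)
  s-dec  : ∀ {i r j k n ρ} → nth d i ≡ just (jzdec r j k) → ρ r ≡ suc n →
           Step d (suc i , ρ) (k , setReg r n ρ)

step-det : ∀ {d c c₁ c₂} → Step d c c₁ → Step d c c₂ → c₁ ≡ c₂
step-det (s-inc e) (s-inc f) with refl ← trans (sym e) f = refl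
step-det (s-inc e) (s-zero f _) with () ← trans (sym e) f
step-det (s-inc e) (s-dec f _) with () ← trans (sym e) f
step-det (s-zero e _) (s-inc f) with () ← trans (sym e) f
step-det (s-zero e _) (s-zero f _) with refl ← trans (sym e) f = refl
step-det (s-zero e z) (s-dec f s) with refl ← trans (sym e) f with () ← trans (sym z) s
step-det (s-dec e _) (s-inc f) with () ← trans (sym e) f
step-det (s-dec e s) (s-zero f z) with refl ← trans (sym e) f with () ← trans (sym z) s
step-det (s-dec e s) (s-dec f t) with refl ← trans (sym e) f with refl ← trans (sym s) t = refl

Reaches : Program → Config → Config → Set
Reaches d = Star (Step d)

loop-stays : ∀ {d c c'} → Step d c c → Reaches d c c' → c' ≡ c
loop-stays s ε = refl
loop-stays s (s' ◅ ss) with refl ← step-det s s' = loop-stays s ss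

-- By determinism the two runs share their steps until one of them ends: no step leaves address 0,
-- and the loop is never left.
looping-never-halts : ∀ {d c i ρ ρ'} → Reaches d c (suc i , ρ) → Step d (suc i , ρ) (suc i , ρ) →
                      ¬ Reaches d c (0 , ρ')
looping-never-halts ε s ss with () ← loop-stays s ss
looping-never-halts (t ◅ ts) s (t' ◅ ss) with refl ← step-det t t' = looping-never-halts ts s ss

nth-++ˡ : ∀ xs ys {i I} → nth xs i ≡ just I → nth (xs ++ ys) i ≡ just I
nth-++ˡ (x ∷ xs) ys {zero}  e = e
nth-++ˡ (x ∷ xs) ys {suc i} e = nth-++ˡ xs ys e

nth-++ʳ : ∀ xs ys i → nth (xs ++ ys) (length xs + i) ≡ nth ys i
nth-++ʳ []       ys i = refl
nth-++ʳ (x ∷ xs) ys i = nth-++ʳ xs ys i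

-- Structured programs on five registers

State : Set
State = Vec ℕ 5

-- `loop r c` decrements r before each pass, because `jzdec` tests and decrements at once; a loop
-- thus costs a single instruction besides its body.
data Com : Set where
  incr : Fin 5 → Com
  _⨾_  : Com → Com → Com
  loop : Fin 5 → Com → Com

infixr 5 _⨾_

data Exec : State → Com → State → Set where
  e-incr  : ∀ {xs r} → Exec xs (incr r) (xs [ r ]≔ suc (lookup xs r))
  e-seq   : ∀ {xs ys zs c c'} → Exec xs c ys → Exec ys c' zs → Exec xs (c ⨾ c') zs
  e-done  : ∀ {xs r c} → lookup xs r ≡ 0 → Exec xs (loop r c) xs
  e-again : ∀ {xs ys zs r c n} → lookup xs r ≡ suc n → Exec (xs [ r ]≔ n) c ys →
            Exec ys (loop r c) zs → Exec xs (loop r c) zs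

size : Com → ℕ
size (incr r)   = 1
size (c ⨾ c')   = size c + size c'
size (loop r c) = suc (size c)

-- Code for c at list positions s, s + 1, …, leaving to program counter e;
-- passing e down makes unconditional jumps superfluous.
compile : Com → ℕ → ℕ → Program
compile (incr r)   s e = inc (toℕ r) e ∷ []
compile (c ⨾ c')   s e = compile c s (suc (s + size c)) ++ compile c' (s + size c) e
compile (loop r c) s e = jzdec (toℕ r) e (suc (suc s)) ∷ compile c (suc s) (suc s)

length-compile : ∀ c s e → length (compile c s e) ≡ size c
length-compile (incr r)   s e = refl
length-compile (c ⨾ c')   s e =
  trans (length-++ (compile c s _)) (cong₂ _+_ (length-compile c _ _) (length-compile c' _ _))
length-compile (loop r c) s e = cong suc (length-compile c _ _)

record Placed (d : Program) (s : ℕ) (q : Program) : Set where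
  constructor placed
  field at : ∀ i {I} → nth q i ≡ just I → nth d (s + i) ≡ just I

open Placed

placed-++ˡ : ∀ {d s} q {q'} → Placed d s (q ++ q') → Placed d s q
placed-++ˡ q {q'} pl .at i e = pl .at i (nth-++ˡ q q' e)

placed-++ʳ : ∀ {d s} q {q'} → Placed d s (q ++ q') → Placed d (s + length q) q'
placed-++ʳ {d} {s} q {q'} pl .at i e =
  trans (cong (nth d) (+-assoc s (length q) i)) (pl .at _ (trans (nth-++ʳ q q' i) e))

placed-head : ∀ {d s I q} → Placed d s (I ∷ q) → nth d s ≡ just I
placed-head {d} {s} pl = trans (cong (nth d) (sym (+-identityʳ s))) (pl .at 0 refl)

placed-tail : ∀ {d s I q} → Placed d s (I ∷ q) → Placed d (suc s) q
placed-tail {d} {s} pl .at i e = trans (cong (nth d) (sym (+-suc s i))) (pl .at (suc i) e)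

regs : ∀ {n} → Vec ℕ n → Regs
regs []       q       = 0
regs (x ∷ xs) zero    = x
regs (x ∷ xs) (suc q) = regs xs q

regs-lookup : ∀ {n} (xs : Vec ℕ n) r → regs xs (toℕ r) ≡ lookup xs r
regs-lookup (x ∷ xs) zero    = refl
regs-lookup (x ∷ xs) (suc r) = regs-lookup xs r

regs-update : ∀ {n} (xs : Vec ℕ n) r v → setReg (toℕ r) v (regs xs) ≗ regs (xs [ r ]≔ v)
regs-update (x ∷ xs) zero    v zero    = refl
regs-update (x ∷ xs) zero    v (suc q) = refl
regs-update (x ∷ xs) (suc r) v zero    = refl
regs-update (x ∷ xs) (suc r) v (suc q) = regs-update xs r v q

compile-correct : ∀ {d} c s e {xs ys ρ} → Placed d s (compile c s e) → Exec xs c ys →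
                  ρ ≗ regs xs → ∃[ ρ' ] Reaches d (suc s , ρ) (e , ρ') × ρ' ≗ regs ys
compile-correct (incr r) s e {xs} pl e-incr ρ≗ =
  _ , s-inc (placed-head pl) ◅ ε ,
  λ q → trans (setReg-cong (toℕ r) (cong suc (trans (ρ≗ (toℕ r)) (regs-lookup xs r))) ρ≗ q)
              (regs-update xs r _ q)
compile-correct {d} (c ⨾ c') s e pl (e-seq x x') ρ≗
  with ρ₁ , ss , ρ₁≗ ← compile-correct c s _ (placed-++ˡ (compile c s _) pl) x ρ≗
  with ρ₂ , ss' , ρ₂≗ ← compile-correct c' (s + size c) e
         (subst (λ l → Placed d (s + l) (compile c' (s + size c) e)) (length-compile c s _)
           (placed-++ʳ (compile c s _) pl)) x' ρ₁≗
  = ρ₂ , ss ◅◅ ss' , ρ₂≗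
compile-correct (loop r c) s e {xs} pl (e-done z) ρ≗ =
  _ , s-zero (placed-head pl) (trans (ρ≗ (toℕ r)) (trans (regs-lookup xs r) z)) ◅ ε , ρ≗
compile-correct (loop r c) s e {xs} pl (e-again {n = n} eq x x') ρ≗
  with ρ₁ , ss , ρ₁≗ ← compile-correct c (suc s) (suc s) (placed-tail pl) x
         (λ q → trans (setReg-cong (toℕ r) refl ρ≗ q) (regs-update xs r n q))
  with ρ₂ , ss' , ρ₂≗ ← compile-correct (loop r c) s e pl x' ρ₁≗
  = ρ₂ , s-dec (placed-head pl) (trans (ρ≗ (toℕ r)) (trans (regs-lookup xs r) eq)) ◅ (ss ◅◅ ss') , ρ₂≗

-- Register 3 is scratch space and is 0 between commands.

pattern A = zero
pattern C = suc zero
pattern Y = suc (suc zero)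
pattern S = suc (suc (suc zero))
pattern W = suc (suc (suc (suc zero)))

exec-≡ : ∀ {xs c ys zs} → ys ≡ zs → Exec xs c ys → Exec xs c zs
exec-≡ refl x = x

-- Programs for doubling and pairing

double : Com
double = loop Y (incr S ⨾ incr S) ⨾ loop S (incr Y)

exec-double : ∀ {a c w} y → Exec (a ∷ c ∷ y ∷ 0 ∷ w ∷ []) double (a ∷ c ∷ 2 * y ∷ 0 ∷ w ∷ [])
exec-double {a} {c} {w} y =
  -- For t = 0 the sum `y + (y + t)` left in S is `2 * y` by computation.
  e-seq (fill-S y 0) (exec-≡ (cong (λ v → a ∷ c ∷ v ∷ 0 ∷ w ∷ []) (+-identityʳ (2 * y))) (drain-S (2 * y) 0))
  where
  fill-S : ∀ y t → Exec (a ∷ c ∷ y ∷ t ∷ w ∷ []) (loop Y (incr S ⨾ incr S))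
                        (a ∷ c ∷ 0 ∷ y + (y + t) ∷ w ∷ [])
  fill-S zero    t = e-done refl
  fill-S (suc y) t = e-again refl (e-seq e-incr e-incr)
    (exec-≡ (cong (λ v → a ∷ c ∷ 0 ∷ v ∷ w ∷ [])
      (trans (cong (y +_) (trans (+-suc y (suc t)) (cong suc (+-suc y t)))) (+-suc y (suc (y + t)))))
      (fill-S y (suc (suc t))))
  drain-S : ∀ t y → Exec (a ∷ c ∷ y ∷ t ∷ w ∷ []) (loop S (incr Y)) (a ∷ c ∷ t + y ∷ 0 ∷ w ∷ [])
  drain-S zero    y = e-done refl
  drain-S (suc t) y = e-again refl e-incr
    (exec-≡ (cong (λ v → a ∷ c ∷ v ∷ 0 ∷ w ∷ []) (+-suc t y)) (drain-S t (suc y)))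

2^suc-* : ∀ m y → 2 ^ m * (2 * y) ≡ 2 ^ suc m * y
2^suc-* m y = trans (sym (*-assoc (2 ^ m) 2 y)) (cong (_* y) (*-comm (2 ^ m) 2))

exec-shiftC : ∀ {a w} c y → Exec (a ∷ c ∷ y ∷ 0 ∷ w ∷ []) (loop C double)
                                 (a ∷ 0 ∷ 2 ^ c * y ∷ 0 ∷ w ∷ [])
exec-shiftC {a} {w} zero y =
  exec-≡ (cong (λ v → a ∷ 0 ∷ v ∷ 0 ∷ w ∷ []) (sym (+-identityʳ y))) (e-done refl)
exec-shiftC {a} {w} (suc c) y = e-again refl (exec-double y)
  (exec-≡ (cong (λ v → a ∷ 0 ∷ v ∷ 0 ∷ w ∷ []) (2^suc-* c y)) (exec-shiftC c (2 * y)))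

exec-shiftW : ∀ {a c} w y → Exec (a ∷ c ∷ y ∷ 0 ∷ w ∷ []) (loop W double)
                                 (a ∷ c ∷ 2 ^ w * y ∷ 0 ∷ 0 ∷ [])
exec-shiftW {a} {c} zero y =
  exec-≡ (cong (λ v → a ∷ c ∷ v ∷ 0 ∷ 0 ∷ []) (sym (+-identityʳ y))) (e-done refl)
exec-shiftW {a} {c} (suc w) y = e-again refl (exec-double y)
  (exec-≡ (cong (λ v → a ∷ c ∷ v ∷ 0 ∷ 0 ∷ []) (2^suc-* w y)) (exec-shiftW w (2 * y)))

exec-moveYW : ∀ {a c} y w → Exec (a ∷ c ∷ y ∷ 0 ∷ w ∷ []) (loop Y (incr W))
                                 (a ∷ c ∷ 0 ∷ 0 ∷ y + w ∷ [])
exec-moveYW zero    w = e-done refl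
exec-moveYW {a} {c} (suc y) w = e-again refl e-incr
  (exec-≡ (cong (λ v → a ∷ c ∷ 0 ∷ 0 ∷ v ∷ []) (+-suc y w)) (exec-moveYW y (suc w)))

exec-moveYA : ∀ {c w} y a → Exec (a ∷ c ∷ y ∷ 0 ∷ w ∷ []) (loop Y (incr A))
                                 (y + a ∷ c ∷ 0 ∷ 0 ∷ w ∷ [])
exec-moveYA zero    a = e-done refl
exec-moveYA {c} {w} (suc y) a = e-again refl e-incr
  (exec-≡ (cong (λ v → v ∷ c ∷ 0 ∷ 0 ∷ w ∷ []) (+-suc y a)) (exec-moveYA y (suc a)))

-- There is no empty command, so adding a constant that may be 0 takes the rest of the program as a
-- continuation.
addThen : ℕ → Com → Com
addThen zero    k = k
addThen (suc n) k = incr Y ⨾ addThen n k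

exec-addThen : ∀ n {k a c y w xs} → Exec (a ∷ c ∷ n + y ∷ 0 ∷ w ∷ []) k xs →
               Exec (a ∷ c ∷ y ∷ 0 ∷ w ∷ []) (addThen n k) xs
exec-addThen zero    x = x
exec-addThen (suc n) {k} {a} {c} {y} {w} {xs} x = e-seq e-incr
  (exec-addThen n (subst (λ v → Exec (a ∷ c ∷ v ∷ 0 ∷ w ∷ []) k xs) (sym (+-suc n y)) x))

pairWith : ℕ → Com
pairWith zero    = double ⨾ incr Y
pairWith (suc m) = pairWith m ⨾ double

exec-pairWith : ∀ m {a c y w} → Exec (a ∷ c ∷ y ∷ 0 ∷ w ∷ []) (pairWith m)
                                     (a ∷ c ∷ pair m y ∷ 0 ∷ w ∷ [])
exec-pairWith zero {a} {c} {y} {w} =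
  exec-≡ (cong (λ v → a ∷ c ∷ v ∷ 0 ∷ w ∷ []) (sym (+-identityʳ (suc (2 * y)))))
    (e-seq (exec-double y) e-incr)
exec-pairWith (suc m) {a} {c} {y} {w} =
  exec-≡ (cong (λ v → a ∷ c ∷ v ∷ 0 ∷ w ∷ []) (sym (*-assoc 2 (2 ^ m) (suc (2 * y)))))
    (e-seq (exec-pairWith m) (exec-double _))

-- Since `pair y n` is 2^y (2n + 1), the value y moves to W and counts the doublings of the constant
-- 2n + 1. In `pairWith` the exponent is the constant, and the doublings are unrolled.
pairOnto : ℕ → Com
pairOnto n = loop Y (incr W) ⨾ addThen (suc (2 * n)) (loop W double)

exec-pairOnto : ∀ n {a c y} → Exec (a ∷ c ∷ y ∷ 0 ∷ 0 ∷ []) (pairOnto n)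
                                   (a ∷ c ∷ pair y n ∷ 0 ∷ 0 ∷ [])
exec-pairOnto n {a} {c} {y} = e-seq (exec-moveYW y 0)
  (exec-addThen (suc (2 * n))
    (subst₂ (λ v w → Exec (a ∷ c ∷ v ∷ 0 ∷ w ∷ []) (loop W double) (a ∷ c ∷ pair y n ∷ 0 ∷ 0 ∷ []))
      (sym (+-identityʳ (suc (2 * n)))) (sym (+-identityʳ y)) (exec-shiftW y (suc (2 * n)))))

-- Computing the code of an instance from the code of its skeleton

module CounterCode (z u : ℕ) where

  -- The code of `counter 0 n`, with z the code of the empty counter and u that of the unit prefix:
  -- 4 is the tag of `sum`, `suc` marks `cons`, and the last 0 codes `nil`.
  counterCode : ℕ → ℕ
  counterCode zero    = z
  counterCode (suc n) = pair 4 (suc (pair u (pair (counterCode n) 0)))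

module Prelude (z u K : ℕ) where
  open CounterCode z u

  -- The input is needed twice, as the contents of register 0 and as the code of the skeleton.
  -- Consuming it in A hence leaves a copy in C, while each pass wraps one more unit prefix around
  -- the code in Y.
  count : Com
  count = loop A (incr C ⨾ pairOnto 0 ⨾ pairWith u ⨾ incr Y ⨾ pairWith 4)

  exec-count : ∀ n m c → Exec (n ∷ c ∷ counterCode m ∷ 0 ∷ 0 ∷ []) count
                              (0 ∷ n + c ∷ counterCode (n + m) ∷ 0 ∷ 0 ∷ [])
  exec-count zero    m c = e-done refl
  exec-count (suc n) m c = e-again refl
    (e-seq e-incr (e-seq (exec-pairOnto 0) (e-seq (exec-pairWith u) (e-seq e-incr (exec-pairWith 4)))))
    (exec-≡ (cong₂ (λ v w → 0 ∷ v ∷ counterCode w ∷ 0 ∷ 0 ∷ []) (+-suc n c) (+-suc n m))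
      (exec-count n (suc m) (suc c)))

  -- The tags 3 and 2 belong to `par` and `loc`, the 0 is the location of register 0, and K codes
  -- the components of the instance after its process.
  preludeValue : ℕ → ℕ
  preludeValue c = pair (pair 3 (pair c (pair 2 (pair 0 (counterCode c))))) K

  -- The code is built from the inside out. `double ⨾ incr Y ⨾ loop C double` is a `pair` whose
  -- exponent is read from C. All registers but A end at 0, as the decider run next expects.
  finish : Com
  finish = count ⨾ pairWith 0 ⨾ pairWith 2 ⨾ double ⨾ incr Y ⨾ loop C double ⨾
           pairWith 3 ⨾ pairOnto K ⨾ loop Y (incr A)

  exec-finish : ∀ c → Exec (c ∷ 0 ∷ z ∷ 0 ∷ 0 ∷ []) finish (preludeValue c ∷ 0 ∷ 0 ∷ 0 ∷ 0 ∷ [])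
  exec-finish c =
    e-seq (exec-≡ (cong₂ (λ v w → 0 ∷ v ∷ counterCode w ∷ 0 ∷ 0 ∷ []) (+-identityʳ c) (+-identityʳ c))
            (exec-count c 0 0))
    (e-seq (exec-pairWith 0)
    (e-seq (exec-pairWith 2)
    (e-seq (exec-double _)
    (e-seq e-incr
    (e-seq (exec-shiftC c _)
    (e-seq (exec-pairWith 3)
    (e-seq (exec-pairOnto K)
           (exec-≡ (cong (λ v → v ∷ 0 ∷ 0 ∷ 0 ∷ 0 ∷ []) (+-identityʳ (preludeValue c)))
             (exec-moveYA (preludeValue c) 0)))))))))

  prelude : Com
  prelude = addThen z finish

  exec-prelude : ∀ c → Exec (c ∷ 0 ∷ 0 ∷ 0 ∷ 0 ∷ []) prelude (preludeValue c ∷ 0 ∷ 0 ∷ 0 ∷ 0 ∷ [])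
  exec-prelude c = exec-addThen z
    (subst (λ v → Exec (c ∷ 0 ∷ v ∷ 0 ∷ 0 ∷ []) finish (preludeValue c ∷ 0 ∷ 0 ∷ 0 ∷ 0 ∷ []))
      (sym (+-identityʳ z)) (exec-finish c))

-- Relocated programs; every address outside the original program becomes
-- the first one after the copy.

target : ℕ → ℕ → ℕ → ℕ
target s l i = suc (s + (i ⊓ l))

relocate : ℕ → ℕ → Instr → Instr
relocate s l (inc r j)     = inc r (target s l j)
relocate s l (jzdec r j k) = jzdec r (target s l j) (target s l k)

nth-map : ∀ f p i {I} → nth p i ≡ just I → nth (map f p) i ≡ just (f I)
nth-map f (I ∷ p) zero    refl = refl
nth-map f (I ∷ p) (suc i) e    = nth-map f p i e

nth-just : ∀ p i {I} → nth p i ≡ just I → i < length p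
nth-just (I ∷ p) zero    e = s≤s z≤n
nth-just (I ∷ p) (suc i) e = s≤s (nth-just p i e)

nth-nothing : ∀ p i → nth p i ≡ nothing → length p ≤ i
nth-nothing []      i       e = z≤n
nth-nothing (I ∷ p) (suc i) e = s≤s (nth-nothing p i e)

module _ {d : Program} (s : ℕ) (p : Program) (pl : Placed d s (map (relocate s (length p)) p)) where

  private
    tgt : ℕ → ℕ
    tgt = target s (length p)

  fetch-relocated : ∀ i {I} → nth p i ≡ just I →
                    nth d (s + (i ⊓ length p)) ≡ just (relocate s (length p) I)
  fetch-relocated i e =
    trans (cong (λ l → nth d (s + l)) (m≤n⇒m⊓n≡m (<⇒≤ (nth-just p i e)))) (pl .at i (nth-map _ p i e))

  run-relocated : ∀ f i {ρ₀ ρ o} → run p f (i , ρ₀) ≡ just o → ρ ≗ ρ₀ →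
                  ∃[ ρ' ] Reaches d (tgt i , ρ) (suc (s + length p) , ρ') × ρ' 0 ≡ o
  run-relocated (suc f) i {ρ₀} {ρ} e ρ≗ with nth p i in eq
  -- Here i lies beyond p, so `i ⊓ length p` is `length p`: the copy already stands at its exit.
  ... | nothing = ρ , subst (λ l → Reaches d (tgt i , ρ) (suc (s + l) , ρ)) (m≥n⇒m⊓n≡n (nth-nothing p i eq)) ε ,
                  trans (ρ≗ 0) (just-injective e)
  ... | just (inc r j)
    with ρ' , ss , z ← run-relocated f j e (setReg-cong r (cong suc (ρ≗ r)) ρ≗)
    = ρ' , s-inc (fetch-relocated i eq) ◅ ss , z
  ... | just (jzdec r j k) with ρ₀ r in v
  ... | zero
    with ρ' , ss , z ← run-relocated f j e ρ≗
    = ρ' , s-zero (fetch-relocated i eq) (trans (ρ≗ r) v) ◅ ss , z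
  ... | suc n
    with ρ' , ss , z ← run-relocated f k e (setReg-cong r refl ρ≗)
    = ρ' , s-dec (fetch-relocated i eq) (trans (ρ≗ r) v) ◅ ss , z

start : ℕ → Config
start c = 1 , proj₂ (initConfig c)

-- The diagonal machine

module Diagonal (prelude : Com) (preludeValue : ℕ → ℕ)
  (exec-prelude : ∀ c → Exec (c ∷ 0 ∷ 0 ∷ 0 ∷ 0 ∷ []) prelude (preludeValue c ∷ 0 ∷ 0 ∷ 0 ∷ 0 ∷ []))
  (p : Program) where

  private
    L = size prelude
    final = L + length p

  -- The last instruction sits at address `suc final`. On answer 0 it jumps to itself and leaves the
  -- registers untouched, a genuine loop `Step d c c`; on answer 1 it goes to the halting address 0.
  diagonal : Program
  diagonal = compile prelude 0 (target L (length p) 0) ++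
             map (relocate L (length p)) p ++ jzdec 0 (suc final) 0 ∷ []

  private
    init-regs : ∀ c → proj₂ (initConfig c) ≗ regs (c ∷ 0 ∷ 0 ∷ 0 ∷ 0 ∷ [])
    init-regs c 0 = refl
    init-regs c 1 = refl
    init-regs c 2 = refl
    init-regs c 3 = refl
    init-regs c 4 = refl
    init-regs c (suc (suc (suc (suc (suc q))))) = refl

    zero-regs : ∀ c → regs (c ∷ 0 ∷ 0 ∷ 0 ∷ 0 ∷ []) ≗ proj₂ (initConfig c)
    zero-regs c q = sym (init-regs c q)

    whole : Placed diagonal 0 diagonal
    whole .at i e = e

    placed-rest : Placed diagonal L (map (relocate L (length p)) p ++ jzdec 0 (suc final) 0 ∷ [])
    placed-rest = subst (λ l → Placed diagonal l (map (relocate L (length p)) p ++ jzdec 0 (suc final) 0 ∷ []))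
      (length-compile prelude 0 _) (placed-++ʳ (compile prelude 0 _) whole)

    last-instr : nth diagonal final ≡ just (jzdec 0 (suc final) 0)
    last-instr = placed-head (subst (λ l → Placed diagonal (L + l) (jzdec 0 (suc final) 0 ∷ []))
      (length-map _ p) (placed-++ʳ (map (relocate L (length p)) p) placed-rest))

  diagonal-run : ∀ {c o} → Halts p (preludeValue c) o →
                 ∃[ ρ ] Reaches diagonal (start c) (suc final , ρ) × ρ 0 ≡ o
  diagonal-run {c} (f , e)
    with ρ₁ , ss₁ , ρ₁≗ ← compile-correct prelude 0 _ (placed-++ˡ (compile prelude 0 _) whole)
                            (exec-prelude c) (init-regs c)
    with ρ₂ , ss₂ , z ← run-relocated L p (placed-++ˡ (map (relocate L (length p)) p) placed-rest) f 0 e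
                          (λ q → trans (ρ₁≗ q) (zero-regs _ q))
    = ρ₂ , ss₁ ◅◅ ss₂ , z

  diagonal-halts : ∀ {c} → Halts p (preludeValue c) 1 → ∃[ ρ ] Reaches diagonal (start c) (0 , ρ)
  diagonal-halts h with ρ , ss , one ← diagonal-run h = _ , ss ◅◅ (s-dec last-instr one ◅ ε)

  diagonal-diverges : ∀ {c ρ} → Halts p (preludeValue c) 0 → ¬ Reaches diagonal (start c) (0 , ρ)
  diagonal-diverges h with ρ , ss , z ← diagonal-run h = looping-never-halts ss (s-zero last-instr z)

-- The process encoding

-- `pc i` calls address i; `un r` and `ze r` serve the decrement and the zero test of register r.
-- Locations use the bare number r: a clash with a channel name is harmless, since location and
-- update labels never synchronise with inputs and outputs.
data Chan : Set where
  pc un ze : ℕ → Chan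

abstract
  name : Chan → Name
  name (pc zero)    = 0
  name (un zero)    = 1
  name (ze zero)    = 2
  name (pc (suc i)) = 3 + name (pc i)
  name (un (suc i)) = 3 + name (un i)
  name (ze (suc i)) = 3 + name (ze i)

  shift : Chan → Chan
  shift (pc i) = pc (suc i)
  shift (un i) = un (suc i)
  shift (ze i) = ze (suc i)

  unname : Name → Chan
  unname 0                   = pc 0
  unname 1                   = un 0
  unname 2                   = ze 0
  unname (suc (suc (suc n))) = shift (unname n)

  unname-name : ∀ x → unname (name x) ≡ x
  unname-name (pc zero)    = refl
  unname-name (un zero)    = refl
  unname-name (ze zero)    = refl
  unname-name (pc (suc i)) = cong shift (unname-name (pc i))
  unname-name (un (suc i)) = cong shift (unname-name (un i))
  unname-name (ze (suc i)) = cong shift (unname-name (ze i))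

name-injective : ∀ {x y} → name x ≡ name y → x ≡ y
name-injective {x} {y} e = trans (sym (unname-name x)) (trans (cong unname e) (unname-name y))

-- A register r holding n is r[u.u.⋯.u.!z] with n prefixes u; the • of the
-- increment stands behind a prefix, which the static discipline allows
-- because the contents of a register hold no located process.
incPattern : ℕ → Term
incPattern r = par (loc r (sum (cons (inp (name (un r))) hole nil))) 𝟘

tok : ℕ → Branches
tok i = cons (out (name (pc i))) 𝟘 nil

-- The choice in `jzdec` is settled by the register, which listens on `ze r` when empty and on
-- `un r` otherwise; a wrong branch cannot be taken.
body : Instr → Branches
body (inc r j)     = cons (upd r (incPattern r)) (sum (tok j)) nil
body (jzdec r j k) = cons (out (name (un r))) (sum (tok k)) (cons (out (name (ze r))) (sum (tok j)) nil)

counter : ℕ → ℕ → Term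
counter r zero    = bang (inp (name (ze r))) 𝟘
counter r (suc n) = sum (cons (inp (name (un r))) (counter r n) nil)

-- Transitions of a register

𝟘-stuck : ∀ {α P} → ¬ (𝟘 —[ α ]→ P)
𝟘-stuck (t-sum ())

-- The old value is constrained by equations, as it will be `ρ r`, which cannot be matched against
-- `suc m`.
data CounterStep (r : ℕ) : ℕ → Label → ℕ → Set where
  dec  : ∀ {n m} → n ≡ suc m → CounterStep r n (lin (name (un r))) m
  zero : ∀ {n} → n ≡ 0 → CounterStep r n (lin (name (ze r))) n

-- Zero tests leave residues 𝟘 around the base.
data Counter (r : ℕ) : ℕ → Term → Set where
  base : Counter r 0 (bang (inp (name (ze r))) 𝟘)
  junk : ∀ {Q} → Counter r 0 Q → Counter r 0 (par 𝟘 Q)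
  unit : ∀ {n Q} → Counter r n Q → Counter r (suc n) (sum (cons (inp (name (un r))) Q nil))

counter-Counter : ∀ r n → Counter r n (counter r n)
counter-Counter r zero    = base
counter-Counter r (suc n) = unit (counter-Counter r n)

counter-inv : ∀ {r n Q α Q'} → Counter r n Q → Q —[ α ]→ Q' →
              ∃[ n' ] CounterStep r n α n' × Counter r n' Q'
counter-inv base t-bang = _ , zero refl , junk base
counter-inv (junk c) (t-parl t) = ⊥-elim (𝟘-stuck t)
counter-inv (junk c) (t-parr t) with counter-inv c t
... | _ , zero e , c' = _ , zero e , junk c'
counter-inv (junk c) (t-coml t _) = ⊥-elim (𝟘-stuck t)
counter-inv (junk c) (t-comr _ t) = ⊥-elim (𝟘-stuck t)
counter-inv (junk c) (t-updl t _ _) = ⊥-elim (𝟘-stuck t)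
counter-inv (junk c) (t-updr _ t _) = ⊥-elim (𝟘-stuck t)
counter-inv (unit c) (t-sum here) = _ , dec refl , c

counter-fwd : ∀ {r n α n' Q} → CounterStep r n α n' → Counter r n Q →
              ∃[ Q' ] (Q —[ α ]→ Q') × Counter r n' Q'
counter-fwd (dec refl) (unit c) = _ , t-sum here , c
counter-fwd (zero e) base = _ , t-bang , junk base
counter-fwd (zero e) (junk c) with _ , t , c' ← counter-fwd (zero e) c = _ , t-parr t , junk c'

-- Together with `counter-numap` this gives `condS` for an increment: the tree stays a single node
-- r, and the hole behind a prefix demands `numap Q ≡ 0`.
counter-cstr : ∀ {r n Q} → Counter r n Q → cstrChildren Q ≡ []
counter-cstr base     = refl
counter-cstr (junk c) = counter-cstr c
counter-cstr (unit c) = refl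

counter-numap : ∀ {r n Q} → Counter r n Q → numap Q ≡ 0
counter-numap base     = refl
counter-numap (junk c) = counter-numap c
counter-numap (unit c) = refl

-- Static update patterns have the form a[U] ∥ A, so every increment leaves a 𝟘 beside the register;
-- `junk` absorbs it.
data Slot (r n : ℕ) : Term → Set where
  cell : ∀ {Q} → Counter r n Q → Slot r n (loc r Q)
  junk : ∀ {s} → Slot r n s → Slot r n (par s 𝟘)

incremented : ℕ → Term → Term → Term
incremented r Q s = substStar s (fill (incPattern r) Q)

-- A register that offers itself leaves ⋆ behind and is no slot any more; `yields` therefore speaks
-- of the term after the increment has filled the placeholder.
data SlotOutcome (r n : ℕ) : Label → Term → Set where
  counts  : ∀ {α n' s'} → CounterStep r n α n' → Slot r n' s' → SlotOutcome r n α s'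
  yields  : ∀ {Q s'} → Slot r (suc n) (incremented r Q s') → SlotOutcome r n (lloc r Q) s'

slot-inv : ∀ {r n s α s'} → Slot r n s → s —[ α ]→ s' → SlotOutcome r n α s'
slot-inv (cell c) t-loc = yields (junk (cell (unit c)))
slot-inv (cell c) (t-inloc t) with _ , st , c' ← counter-inv c t = counts st (cell c')
slot-inv (junk s) (t-parl t) with slot-inv s t
... | counts st s' = counts st (junk s')
... | yields s'    = yields (junk s')
slot-inv (junk s) (t-parr t) = ⊥-elim (𝟘-stuck t)
slot-inv (junk s) (t-coml _ t) = ⊥-elim (𝟘-stuck t)
slot-inv (junk s) (t-comr t _) = ⊥-elim (𝟘-stuck t)
slot-inv (junk s) (t-updl _ t _) = ⊥-elim (𝟘-stuck t)
slot-inv (junk s) (t-updr t _ _) = ⊥-elim (𝟘-stuck t)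

slot-count : ∀ {r n α n' s} → CounterStep r n α n' → Slot r n s → ∃[ s' ] (s —[ α ]→ s') × Slot r n' s'
slot-count st (cell c) with _ , t , c' ← counter-fwd st c = _ , t-inloc t , cell c'
slot-count st (junk s) with _ , t , s' ← slot-count st s = _ , t-parl t , junk s'

slot-fetch : ∀ {r n s} → Slot r n s →
             ∃[ Q ] ∃[ s' ] (s —[ lloc r Q ]→ s') × condS r (incPattern r) Q × Slot r (suc n) (incremented r Q s')
slot-fetch {r} (cell {Q} c) = _ , _ , t-loc ,
  (_ , _ , refl , node≅ same-tree , λ _ → counter-numap c) , junk (cell (unit c))
  where
  same-tree : (node (just r) (cstrChildren Q) ∷ []) ≅F (node (just r) [] ∷ [])
  same-tree rewrite counter-cstr c = ∷≅ {xs = []} (node≅ []≅) []≅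
slot-fetch (junk s) with _ , _ , t , c , s' ← slot-fetch s = _ , _ , t-parl t , c , junk s'

-- Servers and the single control thread

server : ℕ → Branches → Term
server i bs = bang (inp (name (pc i))) (sum bs)

data Has (B : Term) : Term → Set where
  here  : Has B B
  left  : ∀ {s t} → Has B s → Has B (par s t)
  right : ∀ {s t} → Has B t → Has B (par s t)

haltBarb : Barb
haltBarb = bout (name (pc 0))

module Encoding (d : Program) where

  -- The server at address 0 answers with the token that called it. A halted system thus reduces
  -- forever with the barb in place, which turns one barb into an infinite sequence of them.
  data Handler : ℕ → Branches → Set where
    halted : Handler 0 (tok 0)
    instr  : ∀ {i I} → nth d i ≡ just I → Handler (suc i) (body I)

  data Thread : Set where
    token   : ℕ → Thread
    running : Instr → Thread

  term : Thread → Term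
  term (token i)   = sum (tok i)
  term (running I) = sum (body I)

  -- Labels are given by equations because `name x` cannot be matched against `name y`;
  -- `name-injective` settles them later.
  data ThreadStep : Thread → Label → Term → Set where
    call : ∀ {i α} → α ≡ lout (name (pc i)) → ThreadStep (token i) α 𝟘
    incr : ∀ {r j α} → α ≡ lupd r (incPattern r) → ThreadStep (running (inc r j)) α (sum (tok j))
    dec  : ∀ {r j k α} → α ≡ lout (name (un r)) → ThreadStep (running (jzdec r j k)) α (sum (tok k))
    zero : ∀ {r j k α} → α ≡ lout (name (ze r)) → ThreadStep (running (jzdec r j k)) α (sum (tok j))

  thread-inv : ∀ {α th'} T → term T —[ α ]→ th' → ThreadStep T α th'
  thread-inv (token i)               (t-sum here)         = call refl
  thread-inv (running (inc r j))     (t-sum here)         = incr refl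
  thread-inv (running (jzdec r j k)) (t-sum here)         = dec refl
  thread-inv (running (jzdec r j k)) (t-sum (there here)) = zero refl

  data Idle : Term → Set where
    dead   : Idle 𝟘
    serves : ∀ {i bs} → Handler i bs → Idle (server i bs)
    _∥_    : ∀ {s t} → Idle s → Idle t → Idle (par s t)

  data Active (th : Term) : Term → Set where
    here  : Active th th
    left  : ∀ {s t} → Active th s → Idle t → Active th (par s t)
    right : ∀ {s t} → Idle s → Active th t → Active th (par s t)

  active-idle : ∀ {th t} → Idle th → Active th t → Idle t
  active-idle i here        = i
  active-idle i (left a j)  = active-idle i a ∥ j
  active-idle i (right j a) = j ∥ active-idle i a

  data IdleOutcome : Label → Term → Set where
    called : ∀ {i bs t} → Handler i bs → Active (sum bs) t → IdleOutcome (lin (name (pc i))) t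

  idle-inv : ∀ {t α t'} → Idle t → t —[ α ]→ t' → IdleOutcome α t'
  idle-inv dead (t-sum ())
  idle-inv (serves h) t-bang = called h (left here (serves h))
  idle-inv (i ∥ j) (t-parl t) with called h a ← idle-inv i t = called h (left a j)
  idle-inv (i ∥ j) (t-parr t) with called h a ← idle-inv j t = called h (right i a)
  idle-inv (i ∥ j) (t-coml _ t) with () ← idle-inv j t
  idle-inv (i ∥ j) (t-comr _ t) with () ← idle-inv i t
  idle-inv (i ∥ j) (t-updl t _ _) with () ← idle-inv i t
  idle-inv (i ∥ j) (t-updr t _ _) with () ← idle-inv j t

  -- After an internal call the remainder th' of the caller lies next to the new thread. Only a
  -- token is known to leave an idle remainder, so the new shape is conditional here and
  -- `valid-call` discharges the condition.
  data ActiveOutcome (th : Term) : Label → Term → Set where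
    listens : ∀ {a t} → ActiveOutcome th (lin a) t
    emits   : ∀ {α th' t} → th —[ α ]→ th' → Active th' t → ActiveOutcome th α t
    calls   : ∀ {i bs th' t} → Handler i bs → th —[ lout (name (pc i)) ]→ th' →
              (Idle th' → Active (sum bs) t) → ActiveOutcome th τ t

  active-inv : ∀ {t α t'} T → Active (term T) t → t —[ α ]→ t' → ActiveOutcome (term T) α t'
  active-inv T here t = emits t here
  active-inv T (left a i) (t-parl t) with active-inv T a t
  ... | listens     = listens
  ... | emits x a'  = emits x (left a' i)
  ... | calls h x f = calls h x (λ e → left (f e) i)
  active-inv T (left a i) (t-parr t) with called _ _ ← idle-inv i t = listens
  active-inv T (left a i) (t-coml _ t) with () ← idle-inv i t
  active-inv T (left a i) (t-comr t t') with called h b ← idle-inv i t with active-inv T a t'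
  ... | emits x a' = calls h x (λ e → right (active-idle e a') b)
  active-inv T (left a i) (t-updl _ t _) with () ← idle-inv i t
  active-inv T (left a i) (t-updr t _ _) with () ← idle-inv i t
  active-inv T (right i a) (t-parr t) with active-inv T a t
  ... | listens     = listens
  ... | emits x a'  = emits x (right i a')
  ... | calls h x f = calls h x (λ e → right i (f e))
  active-inv T (right i a) (t-parl t) with called _ _ ← idle-inv i t = listens
  active-inv T (right i a) (t-comr _ t) with () ← idle-inv i t
  active-inv T (right i a) (t-coml t t') with called h b ← idle-inv i t with active-inv T a t'
  ... | emits x a' = calls h x (λ e → left b (active-idle e a'))
  active-inv T (right i a) (t-updr _ t _) with () ← idle-inv i t
  active-inv T (right i a) (t-updl t _ _) with () ← idle-inv i t

  active-emit : ∀ {th t α th'} → Active th t → th —[ α ]→ th' → ∃[ t' ] (t —[ α ]→ t') × Active th' t'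
  active-emit here        x = _ , x , here
  active-emit (left a i)  x with _ , t , a' ← active-emit a x = _ , t-parl t , left a' i
  active-emit (right i a) x with _ , t , a' ← active-emit a x = _ , t-parr t , right i a'

  idle-call : ∀ {i bs t} → Idle t → Has (server i bs) t →
              ∃[ t' ] (t —[ lin (name (pc i)) ]→ t') × Active (sum bs) t'
  idle-call j here = _ , t-bang , left here j
  idle-call (j ∥ k) (left h)  with _ , t , a ← idle-call j h = _ , t-parl t , left a k
  idle-call (j ∥ k) (right h) with _ , t , a ← idle-call k h = _ , t-parr t , right j a

  active-call : ∀ {bs₀ i bs t} → Active (sum bs₀) t → sum bs₀ —[ lout (name (pc i)) ]→ 𝟘 →
                Has (server i bs) t → ∃[ t' ] (t ⟶ t') × Active (sum bs) t'
  active-call (left a j) x (left h) with _ , t , a' ← active-call a x h = _ , t-parl t , left a' j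
  active-call (left a j) x (right h)
    with _ , t , a' ← active-emit a x with _ , t' , b ← idle-call j h
    = _ , t-comr t' t , right (active-idle dead a') b
  active-call (right j a) x (right h) with _ , t , a' ← active-call a x h = _ , t-parr t , right j a'
  active-call (right j a) x (left h)
    with _ , t , a' ← active-emit a x with _ , t' , b ← idle-call j h
    = _ , t-coml t' t , left b (active-idle dead a')

  has-server : ∀ {i bs t α t'} → Handler i bs → Has (server i bs) t → t —[ α ]→ t' → Has (server i bs) t'
  has-substStar : ∀ {i bs t X} → Handler i bs → Has (server i bs) t → Has (server i bs) (substStar t X)

  has-server h here t-bang = right here
  has-server h (left x) (t-parl t) = left (has-server h x t)
  has-server h (left x) (t-parr t) = left x
  has-server h (left x) (t-coml t _) = left (has-server h x t)
  has-server h (left x) (t-comr _ t) = left (has-server h x t)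
  has-server h (left x) (t-updl t _ _) = left (has-substStar h (has-server h x t))
  has-server h (left x) (t-updr _ t _) = left (has-server h x t)
  has-server h (right x) (t-parl t) = right x
  has-server h (right x) (t-parr t) = right (has-server h x t)
  has-server h (right x) (t-coml _ t) = right (has-server h x t)
  has-server h (right x) (t-comr t _) = right (has-server h x t)
  has-server h (right x) (t-updl _ t _) = right (has-server h x t)
  has-server h (right x) (t-updr t _ _) = right (has-substStar h (has-server h x t))

  has-substStar halted here = here
  has-substStar (instr {I = inc r j} e) here = here
  has-substStar (instr {I = jzdec r j k} e) here = here
  has-substStar h (left x)  = left (has-substStar h x)
  has-substStar h (right x) = right (has-substStar h x)

  -- `Idle` holds for any collection of servers, even an empty one; for the simulation each of them
  -- must be present.
  AllServed : Term → Set
  AllServed t = ∀ {i bs} → Handler i bs → Has (server i bs) t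

  -- The control is the innermost layer, wrapped in registers k, …, k + b - 1.
  data Sys (th : Term) (ρ : Regs) : ℕ → ℕ → Term → Set where
    control : ∀ {k t} → Active th t → AllServed t → Sys th ρ k 0 t
    reg     : ∀ {k b t s} → Sys th ρ (suc k) b t → Slot k (ρ k) s → Sys th ρ k (suc b) (par t s)
    junk    : ∀ {k b t} → Sys th ρ k b t → Sys th ρ k b (par t 𝟘)

  sys-cong : ∀ {th ρ ρ' k b t} → (∀ r → k ≤ r → ρ' r ≡ ρ r) → Sys th ρ k b t → Sys th ρ' k b t
  sys-cong e (control a h) = control a h
  sys-cong {k = k} e (reg x s) =
    reg (sys-cong (λ r k<r → e r (<⇒≤ k<r)) x) (subst (λ n → Slot k n _) (sym (e k ≤-refl)) s)
  sys-cong e (junk x) = junk (sys-cong e x)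

  -- Transitions of the whole system

  data Effect (ρ : Regs) (r : ℕ) : Label → Regs → Set where
    dec  : ∀ {n} → ρ r ≡ suc n → Effect ρ r (lout (name (un r))) (setReg r n ρ)
    zero : ρ r ≡ 0 → Effect ρ r (lout (name (ze r))) ρ
    incr : Effect ρ r (lupd r (incPattern r)) (setReg r (suc (ρ r)) ρ)

  effect-other : ∀ {ρ r β ρ'} q → q ≢ r → Effect ρ r β ρ' → ρ' q ≡ ρ q
  effect-other {ρ} {r} q q≢r (dec e)  = setReg-other r _ ρ q q≢r
  effect-other           q q≢r (zero e) = refl
  effect-other {ρ} {r} q q≢r incr     = setReg-other r _ ρ q q≢r

  effect-above : ∀ {th ρ k β ρ' b t} → Effect ρ k β ρ' → Sys th ρ (suc k) b t → Sys th ρ' (suc k) b t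
  effect-above e = sys-cong (λ r k<r → effect-other r (>⇒≢ k<r) e)

  reg-effect : ∀ {th ρ k r β ρ' b t s} → Effect ρ r β ρ' → k < r → Sys th ρ' (suc k) b t →
               Slot k (ρ k) s → Sys th ρ' k (suc b) (par t s)
  reg-effect {k = k} e k<r x s = reg x (subst (λ n → Slot k n _) (sym (effect-other k (<⇒≢ k<r) e)) s)

  slot-set : ∀ {k n s} ρ → Slot k n s → Slot k (setReg k n ρ k) s
  slot-set {k} {n} ρ s = subst (λ m → Slot k m _) (sym (setReg-same k n ρ)) s

  -- Inputs and location labels carry no data: the layers around offer no output and no update, so
  -- nothing there can answer them. A τ is hence a call inside the control or a meeting of the
  -- thread with one register.
  data Outcome (th : Term) (ρ : Regs) (k b : ℕ) : Label → Term → Set where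
    listens : ∀ {a t} → Outcome th ρ k b (lin a) t
    yields  : ∀ {a Q t} → Outcome th ρ k b (lloc a Q) t
    emits   : ∀ {α th' t} → th —[ α ]→ th' → Sys th' ρ k b t → Outcome th ρ k b α t
    calls   : ∀ {i bs th' t} → Handler i bs → th —[ lout (name (pc i)) ]→ th' →
              (Idle th' → Sys (sum bs) ρ k b t) → Outcome th ρ k b τ t
    affects : ∀ {r β th' ρ' t} → Effect ρ r β ρ' → k ≤ r → th —[ β ]→ th' →
              Sys th' ρ' k b t → Outcome th ρ k b τ t

  upd-incPattern : ∀ {a U th'} T → term T —[ lupd a U ]→ th' → U ≡ incPattern a
  upd-incPattern T x with incr refl ← thread-inv T x = refl

  sys-inv : ∀ {ρ k b t α t'} T → Sys (term T) ρ k b t → t —[ α ]→ t' → Outcome (term T) ρ k b α t'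
  sys-inv T (control a h) t with active-inv T a t
  ... | listens      = listens
  ... | emits x a'   = emits x (control a' (λ g → has-server g (h g) t))
  ... | calls g x f  = calls g x (λ i → control (f i) (λ g' → has-server g' (h g') t))
  sys-inv T (reg x s) (t-parl t) with sys-inv T x t
  ... | listens         = listens
  ... | yields          = yields
  ... | emits y x'      = emits y (reg x' s)
  ... | calls g y f     = calls g y (λ i → reg (f i) s)
  ... | affects e k<r y x' = affects e (<⇒≤ k<r) y (reg-effect e k<r x' s)
  sys-inv T (reg x s) (t-parr t) with slot-inv s t
  ... | counts (dec _) _  = listens
  ... | counts (zero _) _ = listens
  ... | yields _          = yields
  sys-inv T (reg x s) (t-coml _ t) with slot-inv s t
  ... | counts () _
  sys-inv {ρ} T (reg x s) (t-comr t t') with slot-inv s t | sys-inv T x t'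
  ... | counts (dec e) s'  | emits y x' =
    affects (dec e) ≤-refl y
      (reg (effect-above (dec e) x') (slot-set ρ s'))
  ... | counts (zero e) s' | emits y x' =
    affects (zero e) ≤-refl y (reg x' s')
  sys-inv T (reg x s) (t-updl _ t _) with slot-inv s t
  ... | counts () _
  sys-inv {ρ} T (reg x s) (t-updr t t' _) with slot-inv s t | sys-inv T x t'
  ... | yields s' | emits y x' with refl ← upd-incPattern T y =
    affects incr ≤-refl y
      (reg (effect-above incr x') (slot-set ρ s'))
  sys-inv T (junk x) (t-parl t) with sys-inv T x t
  ... | listens          = listens
  ... | yields           = yields
  ... | emits y x'       = emits y (junk x')
  ... | calls g y f      = calls g y (λ i → junk (f i))
  ... | affects e k≤r y x' = affects e k≤r y (junk x')
  sys-inv T (junk x) (t-parr t)     = ⊥-elim (𝟘-stuck t)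
  sys-inv T (junk x) (t-coml _ t)   = ⊥-elim (𝟘-stuck t)
  sys-inv T (junk x) (t-comr t _)   = ⊥-elim (𝟘-stuck t)
  sys-inv T (junk x) (t-updl _ t _) = ⊥-elim (𝟘-stuck t)
  sys-inv T (junk x) (t-updr t _ _) = ⊥-elim (𝟘-stuck t)

  sys-emit : ∀ {th ρ k b t α th'} → Sys th ρ k b t → th —[ α ]→ th' → ∃[ t' ] (t —[ α ]→ t') × Sys th' ρ k b t'
  sys-emit (control a h) x with _ , t , a' ← active-emit a x = _ , t , control a' (λ g → has-server g (h g) t)
  sys-emit (reg y s) x with _ , t , y' ← sys-emit y x = _ , t-parl t , reg y' s
  sys-emit (junk y)  x with _ , t , y' ← sys-emit y x = _ , t-parl t , junk y'

  sys-call : ∀ {i bs ρ k b t} → Handler i bs → Sys (sum (tok i)) ρ k b t → ∃[ t' ] (t ⟶ t') × Sys (sum bs) ρ k b t'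
  sys-call g (control a h) with _ , t , a' ← active-call a (t-sum here) (h g) =
    _ , t , control a' (λ g' → has-server g' (h g') t)
  sys-call g (reg x s) with _ , t , x' ← sys-call g x = _ , t-parl t , reg x' s
  sys-call g (junk x)  with _ , t , x' ← sys-call g x = _ , t-parl t , junk x'

  slot-effect : ∀ {th ρ k β ρ' th' b t s} → Effect ρ k β ρ' → Sys th ρ (suc k) b t → Slot k (ρ k) s →
                th —[ β ]→ th' → ∃[ t' ] (par t s ⟶ t') × Sys th' ρ' k (suc b) t'
  slot-effect {ρ = ρ} (dec e) x s y
    with _ , t , x' ← sys-emit x y with _ , t' , s' ← slot-count (dec e) s
    = _ , t-comr t' t , reg (effect-above (dec e) x') (slot-set ρ s')
  slot-effect (zero e) x s y
    with _ , t , x' ← sys-emit x y with _ , t' , s' ← slot-count (zero e) s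
    = _ , t-comr t' t , reg x' s'
  slot-effect {ρ = ρ} incr x s y
    with _ , t , x' ← sys-emit x y with _ , _ , t' , c , s' ← slot-fetch s
    = _ , t-updr t' t c , reg (effect-above incr x') (slot-set ρ s')

  sys-effect : ∀ {th ρ r β ρ' th' k b t} → Effect ρ r β ρ' → k ≤ r → r < k + b → Sys th ρ k b t →
               th —[ β ]→ th' → ∃[ t' ] (t ⟶ t') × Sys th' ρ' k b t'
  sys-effect {r = r} {k = k} e k≤r r< (control a h) y =
    ⊥-elim (<⇒≱ (subst (r <_) (+-identityʳ k) r<) k≤r)
  sys-effect {r = r} e k≤r r< (reg {k} {b} x s) y with m≤n⇒m<n∨m≡n k≤r
  ... | inj₂ refl = slot-effect e x s y
  ... | inj₁ k<r with _ , t , x' ← sys-effect e k<r (subst (r <_) (+-suc k b) r<) x y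
    = _ , t-parl t , reg-effect e k<r x' s
  sys-effect e k≤r r< (junk x) y with _ , t , x' ← sys-effect e k≤r r< x y = _ , t-parl t , junk x'

  -- Operational correspondence

  -- A machine step takes two reductions, the call of a server and the meeting with a register;
  -- `at-body` is the state between them.
  data Valid (c₀ : Config) : Thread → Regs → Set where
    at-token : ∀ {i ρ} → Reaches d c₀ (i , ρ) → Valid c₀ (token i) ρ
    at-body  : ∀ {i I ρ} → Reaches d c₀ (suc i , ρ) → nth d i ≡ just I → Valid c₀ (running I) ρ

  lout-name-injective : ∀ {x y} → lout (name x) ≡ lout (name y) → x ≡ y
  lout-name-injective e = name-injective (lout-injective e)
    where
    lout-injective : ∀ {a b} → lout a ≡ lout b → a ≡ b
    lout-injective refl = refl

  lupd-name-injective : ∀ {a b U V} → lupd a U ≡ lupd b V → a ≡ b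
  lupd-name-injective refl = refl

  ValidTerm : Config → Term → Regs → Set
  ValidTerm c₀ th ρ = ∃[ T ] th ≡ term T × Valid c₀ T ρ

  ValidSys : Config → ℕ → Term → Set
  ValidSys c₀ b t = ∃[ T ] ∃[ ρ ] Valid c₀ T ρ × Sys (term T) ρ 0 b t

  valid-call : ∀ {c₀ i bs T th' ρ} → Handler i bs → Valid c₀ T ρ → term T —[ lout (name (pc i)) ]→ th' →
               Idle th' × ValidTerm c₀ (sum bs) ρ
  valid-call g (at-token ss) x with thread-inv (token _) x
  ... | call e with lout-name-injective e
  valid-call halted    (at-token ss) x | call e | refl = dead , _ , refl , at-token ss
  valid-call (instr n) (at-token ss) x | call e | refl = dead , _ , refl , at-body ss n
  valid-call g (at-body {I = I} ss n) x with thread-inv (running I) x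
  ... | incr ()
  ... | dec e  with () ← lout-name-injective e
  ... | zero e with () ← lout-name-injective e

  valid-effect : ∀ {c₀ r β T th' ρ ρ'} → Effect ρ r β ρ' → Valid c₀ T ρ → term T —[ β ]→ th' →
                 ValidTerm c₀ th' ρ'
  valid-effect f (at-token ss) x with thread-inv (token _) x
  valid-effect (dec _)  (at-token ss) x | call e with () ← lout-name-injective e
  valid-effect (zero _) (at-token ss) x | call e with () ← lout-name-injective e
  valid-effect incr     (at-token ss) x | call ()
  valid-effect f (at-body {I = I} ss n) x with thread-inv (running I) x
  valid-effect incr (at-body ss n) x | incr e with refl ← lupd-name-injective e =
    _ , refl , at-token (ss ◅◅ (s-inc n ◅ ε))
  valid-effect (dec z) (at-body ss n) x | dec e with refl ← lout-name-injective e =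
    _ , refl , at-token (ss ◅◅ (s-dec n z ◅ ε))
  valid-effect (zero z) (at-body ss n) x | dec e with () ← lout-name-injective e
  valid-effect (dec z) (at-body ss n) x | zero e with () ← lout-name-injective e
  valid-effect (zero z) (at-body ss n) x | zero e with refl ← lout-name-injective e =
    _ , refl , at-token (ss ◅◅ (s-zero n z ◅ ε))

  thread-not-τ : ∀ {th'} T → ¬ (term T ⟶ th')
  thread-not-τ T x with thread-inv T x
  ... | call ()
  ... | incr ()
  ... | dec ()
  ... | zero ()

  valid-step : ∀ {c₀ b t t'} → ValidSys c₀ b t → t ⟶ t' → ValidSys c₀ b t'
  valid-step (T , ρ , v , x) t with sys-inv T x t
  ... | emits y _ = ⊥-elim (thread-not-τ T y)
  ... | calls g y f with i , T' , eq , v' ← valid-call g v y =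
    T' , _ , v' , subst (λ th → Sys th _ _ _ _) eq (f i)
  ... | affects e _ y x' with T' , refl , v' ← valid-effect e v y = T' , _ , v' , x'

  valid-steps : ∀ {c₀ b t t'} → ValidSys c₀ b t → t ⟶* t' → ValidSys c₀ b t'
  valid-steps v ε        = v
  valid-steps v (t ◅ ts) = valid-steps (valid-step v t) ts

  barb-halts : ∀ {c₀ b t} → ValidSys c₀ b t → t ↓ haltBarb → ∃[ ρ ] Reaches d c₀ (0 , ρ)
  barb-halts (T , ρ , v , x) (_ , t) with sys-inv T x t
  ... | emits y _ with thread-inv T y
  barb-halts (_ , ρ , at-token ss , x) _ | emits y _ | call e with refl ← lout-name-injective e = ρ , ss
  barb-halts (_ , ρ , at-body _ _ , x) _ | emits y _ | dec e  with () ← lout-name-injective e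
  barb-halts (_ , ρ , at-body _ _ , x) _ | emits y _ | zero e with () ← lout-name-injective e

  -- Simulation of the machine

  register : Instr → ℕ
  register (inc r j)     = r
  register (jzdec r j k) = r

  simulate-step : ∀ {b i ρ c t} → (∀ {i I} → nth d i ≡ just I → register I < b) → Step d (i , ρ) c →
                  Sys (sum (tok i)) ρ 0 b t → ∃[ t' ] (t ⟶* t') × Sys (sum (tok (proj₁ c))) (proj₂ c) 0 b t'
  simulate-step bd (s-inc n) x
    with _ , t , x' ← sys-call (instr n) x
    with _ , t' , x'' ← sys-effect incr z≤n (bd n) x' (t-sum here) = _ , t ◅ t' ◅ ε , x''
  simulate-step bd (s-zero n e) x
    with _ , t , x' ← sys-call (instr n) x
    with _ , t' , x'' ← sys-effect (zero e) z≤n (bd n) x' (t-sum (there here)) = _ , t ◅ t' ◅ ε , x''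
  simulate-step bd (s-dec n e) x
    with _ , t , x' ← sys-call (instr n) x
    with _ , t' , x'' ← sys-effect (dec e) z≤n (bd n) x' (t-sum here) = _ , t ◅ t' ◅ ε , x''

  simulate : ∀ {b i ρ c t} → (∀ {i I} → nth d i ≡ just I → register I < b) → Reaches d (i , ρ) c →
             Sys (sum (tok i)) ρ 0 b t → ∃[ t' ] (t ⟶* t') × Sys (sum (tok (proj₁ c))) (proj₂ c) 0 b t'
  simulate bd ε x = _ , ε , x
  simulate bd (s ◅ ss) x
    with _ , ts , x' ← simulate-step bd s x with _ , ts' , x'' ← simulate bd ss x' = _ , ts ◅◅ ts' , x''

  halted-barbω : ∀ {ρ b t} → Sys (sum (tok 0)) ρ 0 b t → Barbω t haltBarb
  halted-barbω {ρ} {b} {t} x =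
    (λ i → proj₁ (states i)) , ε , (λ i → proj₁ (proj₂ (next (states i)))) ,
    (λ i → let t' , y , _ = sys-emit (proj₂ (states i)) (t-sum here) in t' , y)
    where
    Halted : Set
    Halted = Σ[ u ∈ Term ] Sys (sum (tok 0)) ρ 0 b u
    next : (h : Halted) → Σ[ u ∈ Term ] (proj₁ h ⟶ u) × Sys (sum (tok 0)) ρ 0 b u
    next (_ , y) = sys-call halted y
    states : ℕ → Halted
    states zero    = t , x
    states (suc i) = proj₁ (next (states i)) , proj₂ (proj₂ (next (states i)))

  -- The initial process

  servers : ℕ → Program → Term
  servers i []      = 𝟘
  servers i (I ∷ q) = par (server (suc i) (body I)) (servers (suc i) q)

  skeletonControl : Term
  skeletonControl = par (par (server 0 (tok 0)) (sum (tok 1))) (servers 0 d)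

  zeroRegisters : ℕ → ℕ → Term
  zeroRegisters k zero    = skeletonControl
  zeroRegisters k (suc b) = par (zeroRegisters (suc k) b) (loc k (counter k 0))

  idle-servers : ∀ i q → Placed d i q → Idle (servers i q)
  idle-servers i []      pl = dead
  idle-servers i (I ∷ q) pl = serves (instr (placed-head pl)) ∥ idle-servers (suc i) q (placed-tail pl)

  has-servers : ∀ i q j {I} → nth q j ≡ just I → Has (server (suc (i + j)) (body I)) (servers i q)
  has-servers i (I ∷ q) zero refl =
    subst (λ l → Has (server (suc l) (body I)) (servers i (I ∷ q))) (sym (+-identityʳ i)) (left here)
  has-servers i (I ∷ q) (suc j) {I'} e =
    subst (λ l → Has (server (suc l) (body I')) (servers i (I ∷ q))) (sym (+-suc i j))
      (right (has-servers (suc i) q j e))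

  control-Sys : ∀ {k ρ} → Sys (sum (tok 1)) ρ k 0 skeletonControl
  control-Sys = control
    (left (right (serves halted) here) (idle-servers 0 d (placed (λ i e → e)))) served
    where
    served : AllServed skeletonControl
    served halted        = left (left here)
    served (instr {i} e) = right (has-servers 0 d i e)

  zeroRegisters-Sys : ∀ {c} k b → Sys (sum (tok 1)) (proj₂ (initConfig c)) (suc k) b (zeroRegisters (suc k) b)
  zeroRegisters-Sys k zero    = control-Sys
  zeroRegisters-Sys k (suc b) = reg (zeroRegisters-Sys (suc k) b) (cell (counter-Counter (suc k) 0))

  registerBound : Program → ℕ
  registerBound []      = 0
  registerBound (I ∷ q) = suc (register I) ⊔ registerBound q

  -- The skeleton holds registers 1 to `registerBound d`; register 0, always added outside, accounts
  -- for the `suc`.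
  register<bound : ∀ q {i I} → nth q i ≡ just I → register I < suc (registerBound q)
  register<bound (I ∷ q) {zero}  refl = m≤n⇒m≤1+n (m≤m⊔n (suc (register I)) (registerBound q))
  register<bound (I ∷ q) {suc i} e    =
    ≤-trans (register<bound q {i} e) (s≤s (m≤n⊔m (suc (register I)) (registerBound q)))

  skeleton : Term
  skeleton = zeroRegisters 1 (registerBound d)

  process : ℕ → Term
  process c = par skeleton (loc 0 (counter 0 c))

  -- The trailing 𝟘 is the empty product that `InBC` attaches when M is empty.
  process-Sys : ∀ c → Sys (sum (tok 1)) (proj₂ (initConfig c)) 0 (suc (registerBound d)) (par (process c) 𝟘)
  process-Sys c = junk (reg (zeroRegisters-Sys 0 (registerBound d)) (cell (counter-Counter 0 c)))

  halts⇒barbω : ∀ {c ρ} → Reaches d (start c) (0 , ρ) → Barbω (par (process c) 𝟘) haltBarb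
  halts⇒barbω {c} ss
    with _ , ts , x ← simulate (λ {i} → register<bound d {i}) ss (process-Sys c)
    with Q , ts' , steps , barbs ← halted-barbω x
    = Q , ts ◅◅ ts' , steps , barbs

  barb⇒halts : ∀ {c Q} → par (process c) 𝟘 ⟶* Q → Q ↓ haltBarb → ∃[ ρ ] Reaches d (start c) (0 , ρ)
  barb⇒halts {c} ts = barb-halts (valid-steps (token 1 , _ , at-token ε , process-Sys c) ts)

  -- The encoding is static

  static-tok : ∀ i → StA (sum (tok i))
  static-tok i = sa-sum (sas-cons s-out (sa-sum sas-nil) sas-nil)

  static-body : ∀ I → StA (sum (body I))
  static-body (inc r j) = sa-sum (sas-cons
    (s-upd (sup-A (sua-sum (suas-cons s-inp sua-hole suas-nil))) (sa-sum sas-nil))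
    (static-tok j) sas-nil)
  static-body (jzdec r j k) = sa-sum (sas-cons s-out (static-tok k) (sas-cons s-out (static-tok j) sas-nil))

  static-servers : ∀ i q → StA (servers i q)
  static-servers i []      = sa-sum sas-nil
  static-servers i (I ∷ q) = sa-par (sa-bang s-inp (static-body I)) (static-servers (suc i) q)

  static-counter : ∀ r n → StA (counter r n)
  static-counter r zero    = sa-bang s-inp (sa-sum sas-nil)
  static-counter r (suc n) = sa-sum (sas-cons s-inp (static-counter r n) sas-nil)

  static-zeroRegisters : ∀ k b → Static (zeroRegisters k b)
  static-zeroRegisters k zero = sp-A
    (sa-par (sa-par (sa-bang s-inp (static-tok 0)) (static-tok 1)) (static-servers 0 d))
  static-zeroRegisters k (suc b) =
    sp-par (static-zeroRegisters (suc k) b) (sp-loc (sp-A (static-counter k 0)))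

  static-process : ∀ c → Static (process c)
  static-process c = sp-par (static-zeroRegisters 1 (registerBound d)) (sp-loc (sp-A (static-counter 0 c)))

-- z and u stand for concrete codes, which are too large to be evaluated.
module Refutation (z u : ℕ)
  (code-counter : ∀ n → codeT (counter 0 n) ≡ CounterCode.counterCode z u n) where

  -- Halting yields an infinite barb and divergence yields none at all. So it suffices that safety
  -- excludes the former and follows from the latter; both problems lie between these extremes.
  undecidable-from-barbs :
    {X : Set} {code : X → ℕ} {D Safe : X → Set} (inst : Term → X) (K : ℕ) →
    (∀ P → code (inst P) ≡ pair (codeT P) K) →
    (∀ P → Static P → D (inst P)) →
    (∀ P → Safe (inst P) → ¬ Barbω (par P 𝟘) haltBarb) →
    (∀ P → (∀ Q → par P 𝟘 ⟶* Q → ¬ (Q ↓ haltBarb)) → Safe (inst P)) →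
    Undecidable code D Safe
  undecidable-from-barbs {code = code} {Safe = Safe} inst K code-inst dom sound complete (p , decides) =
    refute (decides (inst P) (dom P (static-process (codeT skeleton))))
    where
    open Prelude z u K
    open Diagonal prelude preludeValue exec-prelude p
    open Encoding diagonal

    P : Term
    P = process (codeT skeleton)

    code-P : code (inst P) ≡ preludeValue (codeT skeleton)
    code-P = trans (code-inst P)
      (cong (λ v → pair (pair 3 (pair (codeT skeleton) (pair 2 (pair 0 v)))) K)
        (code-counter (codeT skeleton)))

    refute : ¬ (Σ[ o ∈ ℕ ] Halts p (code (inst P)) o × ((o ≡ 1 × Safe (inst P)) ⊎ (o ≡ 0 × ¬ Safe (inst P))))
    refute (_ , h , inj₁ (refl , s)) =
      sound P s (halts⇒barbω (proj₂ (diagonal-halts (subst (λ n → Halts p n 1) code-P h))))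
    refute (_ , h , inj₂ (refl , ¬s)) = ¬s (complete P λ Q ts b →
      diagonal-diverges (subst (λ n → Halts p n 0) code-P h) (proj₂ (barb⇒halts ts b)))

-- The two problems as instances

code-counter : ∀ n → codeT (counter 0 n) ≡
               CounterCode.counterCode (codeT (counter 0 0)) (codePre (inp (name (un 0)))) n
code-counter zero    = refl
code-counter (suc n) =
  cong (λ v → pair 4 (suc (pair (codePre (inp (name (un 0)))) (pair v 0)))) (code-counter n)

open Refutation _ _ code-counter

theorem6p3 : Undecidable codeB BDom BoundedAdaptation × Undecidable codeE EDom EventualAdaptation
theorem6p3 =
  undecidable-from-barbs
    (λ P → P , [] , haltBarb , 1) (pair 0 (pair (codeBarb haltBarb) 1)) (λ P → refl)
    (λ P st → st , [] , s≤s z≤n)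
    -- For k = 1 the chain is one state with the barb, so the first state of the infinite run is a
    -- witness.
    (λ { P safe (Q , ts , _ , barbs) → safe (_ , ([] , refl) , Q 0 , ts , barbs 0) })
    (λ { P none (_ , ([] , refl) , Q , ts , b) → none Q ts b }) ,
  undecidable-from-barbs
    (λ P → P , [] , haltBarb) (pair 0 (codeBarb haltBarb)) (λ P → refl)
    (λ P st → st , [])
    (λ { P safe w → safe (_ , ([] , refl) , w) })
    (λ { P none (_ , ([] , refl) , Q , ts , _ , barbs) → none (Q 0) ts (barbs 0) })
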